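{- The following equalities of functions hold: $$\mathrm{nat2hfp}\circ\mathrm{hfp2nat}=\mathrm{id}_{HFP},\qquad \mathrm{hfp2nat}\circ\mathrm{nat2hfp}=\mathrm{id}_{\mathbb{N}}.$$
   Context: $\mathbb{N}=\{0,1,2,\dots\}$. $P$ is the set of all finite permutations: lists $[p_0,\dots,p_{k-1}]$, $k\ge0$, in which each element of $\{0,\dots,k-1\}$ occurs exactly once (the empty list is the unique permutation of size $0$). For $k\ge1$, the Lehmer code of a permutation $[p_0,\dots,p_{k-1}]$, as computed in the paper, is the list $[c_0,\dots,c_{k-1}]$ obtained as follows: start with the list $[0,1,\dots,k-1]$; for $i=0,\dots,k-1$ in turn, let $c_i$ be the position (counted from $0$) of $p_i$ in the current list, and then remove $p_i$, keeping the order of the remaining elements. Set $\mathrm{perm2nth}(p)=\sum_{i=0}^{k-1}c_i\,(k-1-i)!$. For $k\ge1$ and $0\le m<k!$, write $m=\sum_{i=0}^{k-1}d_i\,i!$ with $0\le d_i\le i$, and let $\mathrm{nth2perm}(k,m)$ be the permutation of size $k$ obtained from the list $[0,\dots,k-1]$ by successively selecting and removing the element at position $d_{k-1}$, then $d_{k-2}$, ..., then $d_0$. Let $\mathrm{sf}(k)=\sum_{i=0}^{k-1}i!$. Define $\mathrm{perm2nat}:P\to\mathbb{N}$ by $\mathrm{perm2nat}([\,])=0$ and $\mathrm{perm2nat}(p)=\mathrm{sf}(k)+\mathrm{perm2nth}(p)$ for $p$ of size $k\ge1$. Define $\mathrm{nat2perm}:\mathbb{N}\to P$ by $\mathrm{nat2perm}(0)=[\,]$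 and, for $n>0$, $\mathrm{nat2perm}(n)=\mathrm{nth2perm}(k,n-\mathrm{sf}(k))$, where $k$ is the unique natural number with $\mathrm{sf}(k)\le n<\mathrm{sf}(k+1)$. Fix a constant $U\in\mathbb{N}$ (the paper's default value is $U=0$); the elements of $\{0,\dots,U-1\}$ are called atoms. The set $HFP$ of hereditarily finite permutations and the function $\mathrm{hfp2nat}:HFP\to\mathbb{N}$ are defined simultaneously by recursion: every atom $a$ is in $HFP$, with $\mathrm{hfp2nat}(a)=a$; and a finite (possibly empty) list $[t_0,\dots,t_{k-1}]$ of elements of $HFP$ is in $HFP$ if and only if $[\mathrm{hfp2nat}(t_0),\dots,\mathrm{hfp2nat}(t_{k-1})]\in P$, in which case $\mathrm{hfp2nat}([t_0,\dots,t_{k-1}])=U+\mathrm{perm2nat}([\mathrm{hfp2nat}(t_0),\dots,\mathrm{hfp2nat}(t_{k-1})])$. Nothing else is in $HFP$; atoms and lists are distinct kinds of objects. $\mathrm{nat2hfp}$ is defined recursively on $\mathbb{N}$ by $\mathrm{nat2hfp}(n)=n$ (the atom $n$) if $n<U$, and, if $n\ge U$ and $\mathrm{nat2perm}(n-U)=[n_0,\dots,n_{k-1}]$, $\mathrm{nat2hfp}(n)=[\mathrm{nat2hfp}(n_0),\dots,\mathrm{nat2hfp}(n_{k-1})]$ (the empty list if $\mathrm{nat2perm}(n-U)=[\,]$); each $n_i<n$, so the recursion is well-founded. Part of the meaning of the claim is that $\mathrm{nat2hfp}$ takes values in $HFP$. -}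

module Defs where

open import Data.Fin using (Fin; zero; suc; toℕ; fromℕ<)
open import Data.Fin.Properties using (toℕ-fromℕ<; toℕ<n)
open import Data.List using (List; []; _∷_; map; length; lookup)
open import Data.List.Membership.Propositional using (_∈_; mapWith∈)
open import Data.List.Relation.Unary.All as All using (All; []; _∷_)
open import Data.Nat using (ℕ; zero; suc; _+_; _*_; _∸_; _!; _≤_; _<_; _≟_; _<?_; z≤n; s≤s; NonZero)
open import Data.Nat.DivMod using (_/_; _%_; m≡m%n+[m/n]*n; m%n<n; m<n*o⇒m/o<n)
open import Data.Nat.Induction using (<-wellFounded)
open import Data.Nat.Properties
open import Data.Product using (Σ; ∃; ∃!; _×_; _,_; proj₁; proj₂)
open import Data.Vec as Vec using (Vec; []; _∷_)
open import Data.Vec.Relation.Unary.All as VecAll using ([]; _∷_)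
import Data.Vec.Relation.Unary.All.Properties as VecAllₚ
open import Induction.WellFounded using (Acc; acc)
open import Relation.Binary.PropositionalEquality
open import Relation.Nullary using (yes; no)

-- Each j < k occurs at exactly one position of p, where k is the length of p;
-- by counting, p then has no other entries.
IsPermutation : List ℕ → Set
IsPermutation p =
  ∀ j → j < length p → ∃! _≡_ λ (i : Fin (length p)) → lookup p i ≡ j

-- Factorial-base digits, most significant first: the head of a Code (suc i)
-- is the digit of i !, and it is at most i.
data Code : ℕ → Set where
  []  : Code 0
  _∷_ : ∀ {i} → Fin (suc i) → Code i → Code (suc i)

value : ∀ {k} → Code k → ℕ
value []               = 0
value (_∷_ {i} d ds) = toℕ d * i ! + value ds

-- If p does not occur, the last position is returned; this never happens in
-- the Lehmer code of a permutation.
position : ∀ {n} → ℕ → Vec ℕ (suc n) → Fin (suc n)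
position p (x ∷ [])         = zero
position p (x ∷ xs@(_ ∷ _)) with p ≟ x
... | yes _ = zero
... | no  _ = suc (position p xs)

encode : ∀ {k} → Vec ℕ k → Vec ℕ k → Code k
encode pool []       = []
encode pool (p ∷ ps) = position p pool ∷ encode (Vec.removeAt pool (position p pool)) ps

decode : ∀ {k} → Vec ℕ k → Code k → List ℕ
decode pool []       = []
decode pool (d ∷ ds) = Vec.lookup pool d ∷ decode (Vec.removeAt pool d) ds

-- [0, 1, …, k-1]
range : ∀ k → Vec ℕ k
range k = Vec.tabulate toℕ

lehmer : (p : List ℕ) → Code (length p)
lehmer p = encode (range (length p)) (Vec.fromList p)

perm2nth : List ℕ → ℕ
perm2nth p = value (lehmer p)

factoradic : ∀ k m → m < k ! → Σ (Code k) λ ds → value ds ≡ m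
factoradic zero    m m<1 = [] , sym (n<1⇒n≡0 m<1)
factoradic (suc k) m m<k! = d ∷ proj₁ rest , eq
  where
  instance
    k!≢0 : NonZero (k !)
    k!≢0 = k !≢0
  d<1+k : m / k ! < suc k
  d<1+k = m<n*o⇒m/o<n {m} {suc k} {k !} m<k!
  d = fromℕ< d<1+k
  rest = factoradic k (m % k !) (m%n<n m (k !))
  open ≡-Reasoning
  eq : toℕ d * k ! + value (proj₁ rest) ≡ m
  eq = begin
    toℕ d * k ! + value (proj₁ rest) ≡⟨ cong₂ (λ a b → a * k ! + b) (toℕ-fromℕ< d<1+k) (proj₂ rest) ⟩
    m / k ! * k ! + m % k !          ≡⟨ +-comm (m / k ! * k !) (m % k !) ⟩
    m % k ! + m / k ! * k !          ≡⟨ m≡m%n+[m/n]*n m (k !) ⟨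
    m                                ∎

nth2perm : ∀ k m → m < k ! → List ℕ
nth2perm k m m<k! = decode (range k) (proj₁ (factoradic k m m<k!))

-- 0 ! + 1 ! + … + (k-1) !
sf : ℕ → ℕ
sf zero    = 0
sf (suc k) = sf k + k !

findSize : ∀ n → ∃ λ k → sf k ≤ n × n < sf (suc k)
findSize zero    = 0 , z≤n , s≤s z≤n
findSize (suc n) with findSize n
... | k , lo , hi with suc n <? sf (suc k)
...   | yes lt = k , m≤n⇒m≤1+n lo , lt
...   | no ¬lt = suc k , ≮⇒≥ ¬lt , ≤-<-trans hi (m<m+n (sf (suc k)) (1≤n! (suc k)))

perm2nat : List ℕ → ℕ
perm2nat []         = 0
perm2nat p@(_ ∷ _) = sf (length p) + perm2nth p

nat2perm : ℕ → List ℕ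
nat2perm zero      = []
nat2perm n@(suc _) with findSize n
... | k , lo , hi = nth2perm k (n ∸ sf k) (m<n+o⇒m∸n<o n (sf k) {{k !≢0}} hi)

nat2perm-< : ∀ n → All (_< n) (nat2perm n)
nat2perm-< zero      = []
nat2perm-< n@(suc _) with findSize n
... | k , lo , hi =
  decode⁺ (range k) (proj₁ (factoradic k _ _))
    (VecAllₚ.tabulate⁺ λ i → <-≤-trans (toℕ<n i) (≤-trans (k≤sf k) lo))
  where
  k≤sf : ∀ k → k ≤ sf k
  k≤sf zero    = z≤n
  k≤sf (suc k) = subst (_≤ sf k + k !) (+-comm k 1) (+-mono-≤ (k≤sf k) (1≤n! k))

  remove⁺ : ∀ {k} {xs : Vec ℕ (suc k)} i →
            VecAll.All (_< n) xs → VecAll.All (_< n) (Vec.removeAt xs i)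
  remove⁺ zero                (_ ∷ as)          = as
  remove⁺ {xs = _ ∷ _ ∷ _} (suc i) (a ∷ as) = a ∷ remove⁺ i as

  decode⁺ : ∀ {k} (xs : Vec ℕ k) ds → VecAll.All (_< n) xs → All (_< n) (decode xs ds)
  decode⁺ xs []       as = []
  decode⁺ xs (d ∷ ds) as = VecAllₚ.lookup⁺ as d ∷ decode⁺ _ ds (remove⁺ d as)

data Tree : Set where
  atom : ℕ → Tree
  list : List Tree → Tree

module _ (U : ℕ) where

  -- Defined on all trees; only the values on HFP matter.
  hfp2nat  : Tree → ℕ
  -- map hfp2nat, spelled out for the termination checker
  hfp2nats : List Tree → List ℕ

  hfp2nat (atom a)  = a
  hfp2nat (list ts) = U + perm2nat (hfp2nats ts)

  hfp2nats []       = []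
  hfp2nats (t ∷ ts) = hfp2nat t ∷ hfp2nats ts

  data HFP : Tree → Set where
    atom : ∀ {a} → a < U → HFP (atom a)
    list : ∀ {ts} → All HFP ts → IsPermutation (map hfp2nat ts) → HFP (list ts)

  nat2hfp-acc : ∀ n → Acc _<_ n → Tree
  nat2hfp-acc n (acc rs) with n <? U
  ... | yes _ = atom n
  ... | no  _ = list (mapWith∈ (nat2perm (n ∸ U)) λ {nᵢ} nᵢ∈ →
                  nat2hfp-acc nᵢ (rs (<-≤-trans (All.lookup (nat2perm-< (n ∸ U)) nᵢ∈) (m∸n≤m n U))))

  nat2hfp : ℕ → Tree
  nat2hfp n = nat2hfp-acc n (<-wellFounded n)

{-# OPTIONS --safe #-}

-- Writing k for the length of the result, both nat2perm and perm2nat are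
-- mediated by codes: perm2nat of a decoded code ds is sf k + value ds, and
-- every number has exactly one such representation because value is a
-- bijection from Code k onto [0, k !). Encoding and decoding are inverse to
-- each other between codes and rearrangements of a pool of distinct entries.
-- The tree bijection follows by well-founded induction on numbers in one
-- direction and structural induction on trees in the other.
module Submission where

open import Defs
open import Data.Fin using (Fin; zero; suc; toℕ; fromℕ<)
open import Data.Fin.Properties using (toℕ-fromℕ<; toℕ<n; toℕ-injective)
open import Data.List using (List; []; _∷_; map; length; lookup; tabulate)
open import Data.List.Membership.Propositional using (_∈_)
open import Data.List.Membership.Propositional.Properties using (∈-lookup; ∈-∃++; mapWith∈-cong; mapWith∈≗map)
open import Data.List.Properties using (map-∘; map-id-local)
open import Data.List.Relation.Binary.Permutation.Propositional using (_↭_; prep; swap; ↭-refl; ↭-sym; ↭-trans; ↭⇒↭ₛ)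
open import Data.List.Relation.Binary.Permutation.Propositional.Properties using (∈-resp-↭; ↭-length; shift; drop-∷)
import Data.List.Relation.Binary.Permutation.Setoid.Properties as ↭ₛ
open import Data.List.Relation.Unary.All as All using (All; []; _∷_)
import Data.List.Relation.Unary.All.Properties as Allₚ
open import Data.List.Relation.Unary.AllPairs using ([]; _∷_)
open import Data.List.Relation.Unary.Any using (here; there; index)
open import Data.List.Relation.Unary.Any.Properties using (lookup-index)
open import Data.List.Relation.Unary.Unique.Propositional using (Unique)
open import Data.List.Relation.Unary.Unique.Propositional.Properties using (Unique[x∷xs]⇒x∉xs; tabulate⁺)
open import Data.Nat using (ℕ; zero; suc; _+_; _*_; _∸_; _!; _≤_; _<_; _≟_; _<?_; z≤n; s≤s)
open import Data.Nat.Induction using (<-wellFounded; <-rec)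
open import Data.Nat.Properties
open import Data.Product using (∃₂; _×_; _,_; proj₁; proj₂)
open import Data.Sum using (inj₁; inj₂)
open import Data.Vec as Vec using (Vec; []; _∷_; toList; fromList; removeAt)
open import Data.Vec.Membership.Propositional.Properties using (∈-tabulate⁺; ∈-toList⁺; ∈-toList⁻)
open import Data.Vec.Properties using (length-toList; toList∘fromList)
import Data.Vec.Relation.Unary.All as VecAll
import Data.Vec.Relation.Unary.All.Properties as VecAllₚ
open import Function using (_∘_)
open import Induction.WellFounded using (Acc; acc)
open import Relation.Binary.Definitions using (tri<; tri≈; tri>)
open import Relation.Binary.PropositionalEquality
open import Relation.Nullary using (yes; no; contradiction)

-- Uniqueness of factorial-base representations.

value<! : ∀ {k} (ds : Code k) → value ds < k !
value<! []               = s≤s z≤n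
value<! (_∷_ {i} d ds) = begin-strict
  toℕ d * i ! + value ds <⟨ +-monoʳ-< (toℕ d * i !) (value<! ds) ⟩
  toℕ d * i ! + i !      ≡⟨ +-comm (toℕ d * i !) (i !) ⟩
  suc (toℕ d) * i !      ≤⟨ *-monoˡ-≤ (i !) (toℕ<n d) ⟩
  suc i !                ∎
  where open ≤-Reasoning

-- If `a < b`, the bound on `r` keeps `a * n + r` below `suc a * n`, hence below `b * n + s`.
-- Applied in both directions it identifies leading digits, the lower digits acting as remainders
-- modulo `i !`.
quotient-≤ : ∀ n {a b r s} → r < n → a * n + r ≡ b * n + s → b ≤ a
quotient-≤ n {a} {b} {r} {s} r<n eq = ≮⇒≥ λ a<b → <-irrefl eq (begin-strict
  a * n + r <⟨ +-monoʳ-< (a * n) r<n ⟩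
  a * n + n ≡⟨ +-comm (a * n) n ⟩
  suc a * n ≤⟨ *-monoˡ-≤ n a<b ⟩
  b * n     ≤⟨ m≤m+n (b * n) s ⟩
  b * n + s ∎)
  where open ≤-Reasoning

value-injective : ∀ {k} (ds es : Code k) → value ds ≡ value es → ds ≡ es
value-injective []       []       _  = refl
value-injective (_∷_ {i} d ds) (e ∷ es) eq
  with refl ← toℕ-injective {i = d} {j = e} (≤-antisym
                (quotient-≤ (i !) (value<! es) (sym eq))
                (quotient-≤ (i !) (value<! ds) eq))
  = cong (d ∷_) (value-injective ds es (+-cancelˡ-≡ (toℕ d * i !) _ _ eq))

sf-mono-≤ : ∀ {j k} → j ≤ k → sf j ≤ sf k
sf-mono-≤ z≤n       = z≤n
sf-mono-≤ (s≤s j≤k) = +-mono-≤ (sf-mono-≤ j≤k) (!-mono-≤ j≤k)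
  where
  !-mono-≤ : ∀ {j k} → j ≤ k → j ! ≤ k !
  !-mono-≤ {k = k} z≤n = 1≤n! k
  !-mono-≤ (s≤s j≤k)   = *-mono-≤ (s≤s j≤k) (!-mono-≤ j≤k)

-- Codes of length `j` are numbered from `sf j` to just below `sf (suc j)`, and these intervals
-- follow each other in increasing order of length.
sf+value< : ∀ {j k} (ds : Code j) (es : Code k) → j < k → sf j + value ds < sf k + value es
sf+value< {j} {k} ds es j<k = begin-strict
  sf j + value ds <⟨ +-monoʳ-< (sf j) (value<! ds) ⟩
  sf (suc j)      ≤⟨ sf-mono-≤ j<k ⟩
  sf k            ≤⟨ m≤m+n (sf k) (value es) ⟩
  sf k + value es ∎
  where open ≤-Reasoning

-- Different lengths give disjoint intervals, so the equation forces `j ≡ k`. Comparing decoded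
-- lists instead of codes keeps the two sides in one type before this is known.
decode-range-unique : ∀ {j k} (ds : Code j) (es : Code k) →
                      sf j + value ds ≡ sf k + value es →
                      decode (range j) ds ≡ decode (range k) es
decode-range-unique {j} {k} ds es eq with <-cmp j k
... | tri< j<k _ _  = contradiction eq (<⇒≢ (sf+value< ds es j<k))
... | tri> _ _ k<j  = contradiction (sym eq) (<⇒≢ (sf+value< es ds k<j))
... | tri≈ _ refl _ = cong (decode (range k)) (value-injective ds es (+-cancelˡ-≡ (sf k) _ _ eq))

nat2perm-decode : ∀ n → ∃₂ λ k (ds : Code k) →
                  nat2perm n ≡ decode (range k) ds × sf k + value ds ≡ n
nat2perm-decode zero      = 0 , [] , refl , refl
nat2perm-decode n@(suc _) with findSize n
... | k , lo , hi =
  k , proj₁ code , refl , trans (cong (sf k +_) (proj₂ code)) (m+[n∸m]≡n lo)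
  where code = factoradic k (n ∸ sf k) (m<n+o⇒m∸n<o n (sf k) {{k !≢0}} hi)

-- The size chosen by `findSize` is never computed: whichever code `nat2perm` decodes represents the
-- same number, so uniqueness settles the result.
nat2perm-sf+value : ∀ {k} (ds : Code k) → nat2perm (sf k + value ds) ≡ decode (range k) ds
nat2perm-sf+value {k} ds with nat2perm-decode (sf k + value ds)
... | _ , es , eq , es-value = trans eq (decode-range-unique es ds es-value)

-- Codes and rearrangements of a pool.

Unique-resp-↭ : ∀ {xs ys : List ℕ} → xs ↭ ys → Unique xs → Unique ys
Unique-resp-↭ = ↭ₛ.Unique-resp-↭ (setoid ℕ) ∘ ↭⇒↭ₛ

removeAt-↭ : ∀ {k} (xs : Vec ℕ (suc k)) i → Vec.lookup xs i ∷ toList (removeAt xs i) ↭ toList xs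
removeAt-↭ (x ∷ xs)         zero    = ↭-refl
removeAt-↭ (x ∷ xs@(_ ∷ _)) (suc i) = ↭-trans (swap _ x ↭-refl) (prep x (removeAt-↭ xs i))

decode-↭ : ∀ {k} (pool : Vec ℕ k) ds → decode pool ds ↭ toList pool
decode-↭ []   []       = ↭-refl
decode-↭ pool (d ∷ ds) = ↭-trans (prep _ (decode-↭ (removeAt pool d) ds)) (removeAt-↭ pool d)

lookup-position : ∀ {n p} (xs : Vec ℕ (suc n)) → p ∈ toList xs → Vec.lookup xs (position p xs) ≡ p
-- On a one-element pool `position` answers `zero` without comparing; membership supplies the
-- equality.
lookup-position         (x ∷ [])         (here p≡x)  = sym p≡x
lookup-position {p = p} (x ∷ xs@(_ ∷ _)) p∈          with p ≟ x
lookup-position         (x ∷ xs@(_ ∷ _)) p∈          | yes p≡x = sym p≡x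
lookup-position         (x ∷ xs@(_ ∷ _)) (here p≡x)  | no p≢x  = contradiction p≡x p≢x
lookup-position         (x ∷ xs@(_ ∷ _)) (there p∈) | no _    = lookup-position xs p∈

lookup-toList-∈ : ∀ {n} (xs : Vec ℕ n) i → Vec.lookup xs i ∈ toList xs
lookup-toList-∈ (x ∷ xs) zero    = here refl
lookup-toList-∈ (x ∷ xs) (suc i) = there (lookup-toList-∈ xs i)

-- `position` stops at the first match; distinctness excludes a match before `i`.
position-lookup : ∀ {n} (xs : Vec ℕ (suc n)) → Unique (toList xs) →
                  ∀ i → position (Vec.lookup xs i) xs ≡ i
position-lookup (x ∷ [])         _          zero = refl
position-lookup (x ∷ xs@(_ ∷ _)) (x≢ ∷ xs!) i    with Vec.lookup (x ∷ xs) i ≟ x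
position-lookup (x ∷ xs@(_ ∷ _)) (x≢ ∷ xs!) zero    | yes _   = refl
position-lookup (x ∷ xs@(_ ∷ _)) (x≢ ∷ xs!) zero    | no x≢x  = contradiction refl x≢x
position-lookup (x ∷ xs@(_ ∷ _)) (x≢ ∷ xs!) (suc i) | yes y≡x =
  contradiction (sym y≡x) (All.lookup x≢ (lookup-toList-∈ xs i))
position-lookup (x ∷ xs@(_ ∷ _)) (x≢ ∷ xs!) (suc i) | no _    = cong suc (position-lookup xs xs! i)

-- The hypothesis is an invariant: `p` is found in the pool, and cancelling it on both sides leaves
-- `ps` a rearrangement of the reduced pool.
decode-encode : ∀ {k} (pool ps : Vec ℕ k) → toList ps ↭ toList pool →
                decode pool (encode pool ps) ≡ toList ps
decode-encode pool []       _ = refl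
decode-encode pool (p ∷ ps) p∷ps↭pool =
  cong₂ _∷_ lookup≡p (decode-encode (removeAt pool i) ps (drop-∷ p∷ps↭p∷rest))
  where
  i = position p pool
  lookup≡p : Vec.lookup pool i ≡ p
  lookup≡p = lookup-position pool (∈-resp-↭ p∷ps↭pool (here refl))
  p∷ps↭p∷rest : p ∷ toList ps ↭ p ∷ toList (removeAt pool i)
  p∷ps↭p∷rest = ↭-trans p∷ps↭pool (subst (λ x → toList pool ↭ x ∷ toList (removeAt pool i))
                                    lookup≡p (↭-sym (removeAt-↭ pool i)))

-- `encode` expects a vector as long as the pool; this form of `decode` keeps the length in the
-- type.
decodeVec : ∀ {k} → Vec ℕ k → Code k → Vec ℕ k
decodeVec pool []       = []
decodeVec pool (d ∷ ds) = Vec.lookup pool d ∷ decodeVec (removeAt pool d) ds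

toList-decodeVec : ∀ {k} (pool : Vec ℕ k) ds → toList (decodeVec pool ds) ≡ decode pool ds
toList-decodeVec pool []       = refl
toList-decodeVec pool (d ∷ ds) = cong (_ ∷_) (toList-decodeVec (removeAt pool d) ds)

-- Each selected digit is recovered by `position-lookup`; the reduced pool stays distinct because it
-- is the tail of a rearrangement of the pool.
encode-decodeVec : ∀ {k} (pool : Vec ℕ k) → Unique (toList pool) → ∀ ds →
                   encode pool (decodeVec pool ds) ≡ ds
encode-decodeVec pool _  []       = refl
encode-decodeVec pool u! (d ∷ ds) rewrite position-lookup pool u! d
  with Unique-resp-↭ (↭-sym (removeAt-↭ pool d)) u!
... | _ ∷ rest! = cong (d ∷_) (encode-decodeVec (removeAt pool d) rest! ds)

-- Stated for an arbitrary length-indexed function, so that no transport along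
-- length (toList xs) ≡ k is needed.
fromList∘toList-elim : ∀ {A : Set} (f : ∀ k → Vec ℕ k → A) {k} (xs : Vec ℕ k) →
                       f (length (toList xs)) (fromList (toList xs)) ≡ f k xs
fromList∘toList-elim f []       = refl
fromList∘toList-elim f (x ∷ xs) = fromList∘toList-elim (λ k ys → f (suc k) (x ∷ ys)) xs

-- Permutations as rearrangements of the range.

∈-range⁺ : ∀ {j k} → j < k → j ∈ toList (range k)
∈-range⁺ {j} {k} j<k = subst (_∈ toList (range k)) (toℕ-fromℕ< j<k)
                         (∈-toList⁺ (∈-tabulate⁺ toℕ (fromℕ< j<k)))

∈-range⁻ : ∀ {j k} → j ∈ toList (range k) → j < k
∈-range⁻ {k = k} j∈ = VecAll.lookup (VecAllₚ.tabulate⁺ {P = _< k} toℕ<n) (∈-toList⁻ j∈)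

toList-tabulate : ∀ {n} (f : Fin n → ℕ) → toList (Vec.tabulate f) ≡ tabulate f
toList-tabulate {zero}  f = refl
toList-tabulate {suc n} f = cong (f zero ∷_) (toList-tabulate (f ∘ suc))

range-unique : ∀ k → Unique (toList (range k))
range-unique k = subst Unique (sym (toList-tabulate {k} toℕ)) (tabulate⁺ toℕ-injective)

-- A pigeonhole argument: `x` is moved to the front of `ys` and cancelled. Since `x` does not recur
-- in `xs`, the inclusion survives for the remainders, and equal lengths leave nothing over at the
-- end.
unique-⊆⇒↭ : ∀ {xs ys : List ℕ} → Unique xs → (∀ {x} → x ∈ xs → x ∈ ys) →
             length xs ≡ length ys → xs ↭ ys
unique-⊆⇒↭ {[]}     {[]} _  _     _  = ↭-refl
unique-⊆⇒↭ {x ∷ xs} {ys} u!@(x≢ ∷ xs!) xs⊆ys len with ∈-∃++ (xs⊆ys (here refl))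
... | as , bs , refl = ↭-trans (prep x (unique-⊆⇒↭ xs! xs⊆rest rest-length)) (↭-sym ys↭)
  where
  ys↭ = shift x as bs
  rest-length = suc-injective (trans len (↭-length ys↭))
  xs⊆rest : ∀ {y} → y ∈ xs → y ∈ _
  xs⊆rest y∈ with ∈-resp-↭ ys↭ (xs⊆ys (there y∈))
  ... | here refl = contradiction y∈ (Unique[x∷xs]⇒x∉xs u!)
  ... | there y∈′ = y∈′

lookup-injective : ∀ {xs : List ℕ} → Unique xs → ∀ i j → lookup xs i ≡ lookup xs j → i ≡ j
lookup-injective (_  ∷ _)   zero    zero    _  = refl
lookup-injective (x≢ ∷ _)   zero    (suc j) eq = contradiction eq (All.lookup x≢ (∈-lookup j))
lookup-injective (x≢ ∷ _)   (suc i) zero    eq = contradiction (sym eq) (All.lookup x≢ (∈-lookup i))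
lookup-injective (_  ∷ xs!) (suc i) (suc j) eq = cong suc (lookup-injective xs! i j eq)

-- The definition places every `j` of the range in `p`, so counting runs from the range, whose
-- entries are distinct, into `p`.
IsPermutation⇒↭range : ∀ {p} → IsPermutation p → p ↭ toList (range (length p))
IsPermutation⇒↭range {p} perm =
  ↭-sym (unique-⊆⇒↭ (range-unique (length p)) range⊆p (length-toList (range (length p))))
  where
  range⊆p : ∀ {j} → j ∈ toList (range (length p)) → j ∈ p
  range⊆p j∈ with perm _ (∈-range⁻ j∈)
  ... | i , refl , _ = ∈-lookup i

-- Leaving `k` free lets this apply directly to `decode (range k) ds`; `k ≡ length p` is recovered
-- from the rearrangement.
↭range⇒IsPermutation : ∀ {p k} → p ↭ toList (range k) → IsPermutation p
↭range⇒IsPermutation {p} {k} p↭ j j<len = index j∈p , sym (lookup-index j∈p) ,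
  λ {i} eq → lookup-injective (Unique-resp-↭ (↭-sym p↭) (range-unique k)) _ i
               (trans (sym (lookup-index j∈p)) (sym eq))
  where
  j∈p : j ∈ p
  j∈p = ∈-resp-↭ (↭-sym p↭)
          (∈-range⁺ (subst (j <_) (trans (↭-length p↭) (length-toList (range k))) j<len))

-- The bijection between permutations and numbers.

perm2nat-sf+perm2nth : ∀ p → perm2nat p ≡ sf (length p) + perm2nth p
perm2nat-sf+perm2nth []      = refl
perm2nat-sf+perm2nth (_ ∷ _) = refl

-- Through `decodeVec` the list becomes `toList` of a vector, the shape in which
-- `fromList∘toList-elim` replaces the computed length by `k`.
perm2nat-decode : ∀ {k} (ds : Code k) → perm2nat (decode (range k) ds) ≡ sf k + value ds
perm2nat-decode {k} ds = begin
  perm2nat (decode (range k) ds)                 ≡⟨ cong perm2nat (toList-decodeVec (range k) ds) ⟨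
  perm2nat (toList xs)                           ≡⟨ perm2nat-sf+perm2nth (toList xs) ⟩
  sf (length (toList xs)) + perm2nth (toList xs) ≡⟨ fromList∘toList-elim (λ j ys → sf j + value (encode (range j) ys)) xs ⟩
  sf k + value (encode (range k) xs)             ≡⟨ cong (λ es → sf k + value es) (encode-decodeVec (range k) (range-unique k) ds) ⟩
  sf k + value ds                                ∎
  where
  open ≡-Reasoning
  xs = decodeVec (range k) ds

perm2nat∘nat2perm : ∀ n → perm2nat (nat2perm n) ≡ n
perm2nat∘nat2perm n with nat2perm-decode n
... | _ , ds , eq , ds-value = trans (cong perm2nat eq) (trans (perm2nat-decode ds) ds-value)

nat2perm∘perm2nat : ∀ {p} → IsPermutation p → nat2perm (perm2nat p) ≡ p
nat2perm∘perm2nat {p} perm = begin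
  nat2perm (perm2nat p)                  ≡⟨ cong nat2perm (perm2nat-sf+perm2nth p) ⟩
  nat2perm (sf (length p) + perm2nth p)  ≡⟨ nat2perm-sf+value (lehmer p) ⟩
  decode (range (length p)) (lehmer p)   ≡⟨ decode-encode (range (length p)) (fromList p)
                                              (subst (_↭ toList (range (length p))) (sym (toList∘fromList p))
                                                (IsPermutation⇒↭range perm)) ⟩
  toList (fromList p)                    ≡⟨ toList∘fromList p ⟩
  p                                      ∎
  where open ≡-Reasoning

nat2perm-IsPermutation : ∀ n → IsPermutation (nat2perm n)
nat2perm-IsPermutation n with nat2perm-decode n
... | k , ds , eq , _ = subst IsPermutation (sym eq) (↭range⇒IsPermutation (decode-↭ (range k) ds))

-- The bijection between trees and numbers.

module _ (U : ℕ) where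

  nat2perm-∸-< : ∀ n → All (_< n) (nat2perm (n ∸ U))
  nat2perm-∸-< n = All.map (λ lt → <-≤-trans lt (m∸n≤m n U)) (nat2perm-< (n ∸ U))

  hfp2nats≡map : ∀ ts → hfp2nats U ts ≡ map (hfp2nat U) ts
  hfp2nats≡map []       = refl
  hfp2nats≡map (t ∷ ts) = cong (_ ∷_) (hfp2nats≡map ts)

  -- Recursive calls inherit accessibility proofs from their caller; this exchanges them for the
  -- canonical `<-wellFounded`.
  nat2hfp-acc-irrelevant : ∀ n (a b : Acc _<_ n) → nat2hfp-acc U n a ≡ nat2hfp-acc U n b
  nat2hfp-acc-irrelevant n (acc rs) (acc ss) with n <? U
  ... | yes _ = refl
  ... | no  _ = cong list (mapWith∈-cong (nat2perm (n ∸ U)) _ _ λ _ → nat2hfp-acc-irrelevant _ (rs _) (ss _))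

  nat2hfp-acc-atom : ∀ {n} → n < U → (a : Acc _<_ n) → nat2hfp-acc U n a ≡ atom n
  nat2hfp-acc-atom {n} n<U (acc _) with n <? U
  ... | yes _   = refl
  ... | no  n≮U = contradiction n<U n≮U

  nat2hfp-acc-list : ∀ {n} → U ≤ n → (a : Acc _<_ n) →
                     nat2hfp-acc U n a ≡ list (map (nat2hfp U) (nat2perm (n ∸ U)))
  nat2hfp-acc-list {n} U≤n (acc rs) with n <? U
  ... | yes n<U = contradiction n<U (≤⇒≯ U≤n)
  ... | no  _   = cong list (trans
    -- Membership evidence enters only through the accessibility proof. Once that is exchanged, the
    -- function ignores it and `mapWith∈` becomes `map`.
    (mapWith∈-cong (nat2perm (n ∸ U)) _ (λ {m} _ → nat2hfp U m) λ _ →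
      nat2hfp-acc-irrelevant _ (rs _) (<-wellFounded _))
    (mapWith∈≗map (nat2hfp U) (nat2perm (n ∸ U))))

  nat2hfp-atom : ∀ {n} → n < U → nat2hfp U n ≡ atom n
  nat2hfp-atom n<U = nat2hfp-acc-atom n<U (<-wellFounded _)

  nat2hfp-list : ∀ {n} → U ≤ n → nat2hfp U n ≡ list (map (nat2hfp U) (nat2perm (n ∸ U)))
  nat2hfp-list U≤n = nat2hfp-acc-list U≤n (<-wellFounded _)

  map-hfp2nat∘nat2hfp : ∀ {ns} → All (λ m → hfp2nat U (nat2hfp U m) ≡ m) ns →
                        map (hfp2nat U) (map (nat2hfp U) ns) ≡ ns
  map-hfp2nat∘nat2hfp {ns} eqs = trans (sym (map-∘ ns)) (map-id-local eqs)

  hfp2nat∘nat2hfp : ∀ n → hfp2nat U (nat2hfp U n) ≡ n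
  hfp2nat∘nat2hfp = <-rec _ step
    where
    step : ∀ n → (∀ {m} → m < n → hfp2nat U (nat2hfp U m) ≡ m) → hfp2nat U (nat2hfp U n) ≡ n
    step n ih with <-≤-connex n U
    ... | inj₁ n<U = cong (hfp2nat U) (nat2hfp-atom {n} n<U)
    ... | inj₂ U≤n = begin
      hfp2nat U (nat2hfp U n)                          ≡⟨ cong (hfp2nat U) (nat2hfp-list {n} U≤n) ⟩
      U + perm2nat (hfp2nats U (map (nat2hfp U) ns))   ≡⟨ cong (λ ms → U + perm2nat ms) (trans (hfp2nats≡map _)
                                                            (map-hfp2nat∘nat2hfp (All.map ih (nat2perm-∸-< n)))) ⟩
      U + perm2nat ns                                  ≡⟨ cong (U +_) (perm2nat∘nat2perm (n ∸ U)) ⟩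
      U + (n ∸ U)                                      ≡⟨ m+[n∸m]≡n U≤n ⟩
      n                                                ∎
      where
      open ≡-Reasoning
      ns = nat2perm (n ∸ U)

  -- The permutation condition concerns the numbers of the subtrees; by `hfp2nat∘nat2hfp` these are
  -- the entries of `nat2perm (n ∸ U)` again.
  nat2hfp-HFP : ∀ n → HFP U (nat2hfp U n)
  nat2hfp-HFP = <-rec _ step
    where
    step : ∀ n → (∀ {m} → m < n → HFP U (nat2hfp U m)) → HFP U (nat2hfp U n)
    step n ih with <-≤-connex n U
    ... | inj₁ n<U = subst (HFP U) (sym (nat2hfp-atom {n} n<U)) (atom n<U)
    ... | inj₂ U≤n = subst (HFP U) (sym (nat2hfp-list {n} U≤n)) (list
      (Allₚ.map⁺ (All.map ih (nat2perm-∸-< n)))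
      (subst IsPermutation {nat2perm (n ∸ U)} (sym (map-hfp2nat∘nat2hfp (All.universal hfp2nat∘nat2hfp _)))
        (nat2perm-IsPermutation (n ∸ U))))

  mutual
    nat2hfp∘hfp2nat : ∀ {t} → HFP U t → nat2hfp U (hfp2nat U t) ≡ t
    nat2hfp∘hfp2nat (atom a<U)            = nat2hfp-atom a<U
    nat2hfp∘hfp2nat (list {ts} hts perm) = begin
      nat2hfp U (U + perm2nat (hfp2nats U ts))                     ≡⟨ nat2hfp-list (m≤m+n U _) ⟩
      list (map (nat2hfp U) (nat2perm (U + perm2nat (hfp2nats U ts) ∸ U)))
        ≡⟨ cong (λ m → list (map (nat2hfp U) (nat2perm m))) (m+n∸m≡n U _) ⟩
      list (map (nat2hfp U) (nat2perm (perm2nat (hfp2nats U ts))))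
        -- `hfp2nat` unfolds to `hfp2nats`, whereas `perm` speaks of `map`.
        ≡⟨ cong (λ ns → list (map (nat2hfp U) (nat2perm (perm2nat ns)))) (hfp2nats≡map ts) ⟩
      list (map (nat2hfp U) (nat2perm (perm2nat (map (hfp2nat U) ts))))
        ≡⟨ cong (list ∘ map (nat2hfp U)) (nat2perm∘perm2nat perm) ⟩
      list (map (nat2hfp U) (map (hfp2nat U) ts))                  ≡⟨ cong list (map-nat2hfp∘hfp2nat hts) ⟩
      list ts                                                      ∎
      where open ≡-Reasoning

    -- Recursion on `All` is spelled out so that each `ht` is visibly a part of the given
    -- derivation.
    map-nat2hfp∘hfp2nat : ∀ {ts} → All (HFP U) ts → map (nat2hfp U) (map (hfp2nat U) ts) ≡ ts
    map-nat2hfp∘hfp2nat []         = refl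
    map-nat2hfp∘hfp2nat (ht ∷ hts) = cong₂ _∷_ (nat2hfp∘hfp2nat ht) (map-nat2hfp∘hfp2nat hts)

proposition9 : ∀ (U : ℕ) →
    (∀ n → HFP U (nat2hfp U n)) ×
    (∀ t → HFP U t → nat2hfp U (hfp2nat U t) ≡ t) ×
    (∀ n → hfp2nat U (nat2hfp U n) ≡ n)
proposition9 U = nat2hfp-HFP U , (λ _ → nat2hfp∘hfp2nat U) , hfp2nat∘nat2hfp U
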